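{- Let $G$ be a finite connected graph, let $t>0$, let $X$ be an optimal Lipschitz function on $G$ (with respect to $t$), and let $w_0,w_1,\ldots,w_k$ ($k\ge1$) be a hair of $G$. Let $m=\min_{0\le i\le k}X(w_i)$ and $M=\max_{0\le i\le k}X(w_i)$. If $G$ has vertices $u_1,\ldots,u_{M-m-1}$ such that $X(u_i)=m+i$ for each $i$ and $\{u_1,\ldots,u_{M-m-1}\}\cap\{w_1,\ldots,w_k\}=\emptyset$, then $X(w_i)-X(w_{i-1})=X(w_{i'})-X(w_{i'-1})$ for all $1\le i,i'\le k$.
   Context: A function $X:V(G)\to\mathbb{R}$ is Lipschitz if $|X(u)-X(v)|\le d_G(u,v)$ for all vertices $u,v$, where $d_G$ is the graph distance; it is treated as a random variable by placing the uniform distribution on $V(G)$. The log-moment function of $X$ is $L_X(t)=\ln\mathbb{E}\big(e^{t(X-\mathbb{E}X)}\big)$, and $L_G(t)=\max_XL_X(t)$ over Lipschitz functions $X$ on $V(G)$. For fixed $t>0$, a Lipschitz function $X$ is optimal if $L_X(t)=L_G(t)$. (For an optimal $X$ all differences of values of $X$ are integers, so $M-m$ is an integer.) $N(v)$ is the set of neighbours of $v$. A hair of $G$ is a sequence of vertices $w_0,w_1,\ldots,w_k$ such that $N(w_i)=\{w_{i-1},w_{i+1}\}$ for $1\le i\le k-1$ and $N(w_k)=\{w_{k-1}\}$.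
   Formalization: The vertices w_0,…,w_k of a hair are required to be distinct; otherwise the sequence a, b, a on a single edge would count as a hair and the claim would fail. -}

module Defs where

open import Algebra.Bundles using (CommutativeRing)
open import Algebra.Definitions.RawMonoid as RawMonoidOps using ()
open import Data.Fin.Base using (Fin; zero; suc; fromℕ; inject₁)
open import Data.Nat.Base as ℕ using (ℕ; zero; suc; NonZero)
open import Data.Product.Base using (∃-syntax; _×_; _,_; proj₁; proj₂)
open import Function.Definitions using (Injective)
open import Level using (Level; _⊔_) renaming (suc to lsuc)
open import Relation.Binary.Core using (Rel)
open import Relation.Binary.Definitions using (Antisymmetric; Cotransitive; Decidable; Irreflexive; Symmetric)
open import Relation.Binary.PropositionalEquality.Core using (_≡_)
open import Relation.Binary.Structures using (IsStrictPartialOrder)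
open import Relation.Nullary.Negation.Core using (¬_)
open import Relation.Unary using (Pred; _≐_; _∪_; ｛_｝)

-- The real numbers, presented as a Cauchy-complete Archimedean ordered field
-- with exp and ln.  Such a field is unique up to isomorphism.  The axioms are
-- those of constructive analysis (in particular, the order is not assumed to
-- be decidable), so classical reals satisfy them as well.

record Reals (c ℓ₁ ℓ₂ : Level) : Set (lsuc (c ⊔ ℓ₁ ⊔ ℓ₂)) where
  infix 4 _<_ _≤_ ∣_∣<_ ∣_∣≤_

  field
    commutativeRing : CommutativeRing c ℓ₁

  open CommutativeRing commutativeRing public hiding (zero)

  field
    _<_ : Rel Carrier ℓ₂

  _≤_ : Rel Carrier ℓ₂
  x ≤ y = ¬ (y < x)

  ∣_∣<_ : Rel Carrier ℓ₂
  ∣ x ∣< y = (- y < x) × (x < y)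

  ∣_∣≤_ : Rel Carrier ℓ₂
  ∣ x ∣≤ y = (- y ≤ x) × (x ≤ y)

  fromℕ# : ℕ → Carrier
  fromℕ# n = RawMonoidOps._×_ +-rawMonoid n 1#

  Cauchy : (ℕ → Carrier) → Set (c ⊔ ℓ₂)
  Cauchy s = ∀ ε → 0# < ε → ∃[ N ] (∀ m n → N ℕ.≤ m → N ℕ.≤ n → ∣ s m - s n ∣< ε)

  _ConvergesTo_ : (ℕ → Carrier) → Carrier → Set (c ⊔ ℓ₂)
  s ConvergesTo l = ∀ ε → 0# < ε → ∃[ N ] (∀ n → N ℕ.≤ n → ∣ s n - l ∣< ε)

  field
    <-isStrictPartialOrder : IsStrictPartialOrder _≈_ _<_
    <-cotransitive         : Cotransitive _<_
    ≤-antisym              : Antisymmetric _≈_ _≤_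
    0<1                    : 0# < 1#
    +-monoˡ-<              : ∀ {x y} z → x < y → x + z < y + z
    *-pos                  : ∀ {x y} → 0# < x → 0# < y → 0# < x * y
    inverse                : ∀ {x} → 0# < x → ∃[ y ] (0# < y × x * y ≈ 1#)
    archimedean            : ∀ x → ∃[ n ] (x < fromℕ# n)
    complete               : ∀ s → Cauchy s → ∃[ l ] (s ConvergesTo l)

    -- These laws determine exp:  for n > ∣x∣,
    -- (1 + x/n)ⁿ ≤ (exp (x/n))ⁿ = exp x ≤ (1 - x/n)⁻ⁿ,
    -- and both bounds tend to eˣ.  Then exp-ln determines ln.
    exp      : Carrier → Carrier
    exp-cong : ∀ {x y} → x ≈ y → exp x ≈ exp y
    exp-pos  : ∀ x → 0# < exp x
    exp-+    : ∀ x y → exp (x + y) ≈ exp x * exp y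
    1+x≤expx : ∀ x → 1# + x ≤ exp x

    ln       : ∀ x → 0# < x → Carrier
    exp-ln   : ∀ x (0<x : 0# < x) → exp (ln x 0<x) ≈ x

  sum : ∀ {n} → (Fin n → Carrier) → Carrier
  sum = RawMonoidOps.sum +-rawMonoid

  open IsStrictPartialOrder <-isStrictPartialOrder public
    using (<-respˡ-≈; <-respʳ-≈) renaming (trans to <-trans)

  +-pos : ∀ {x y} → 0# < x → 0# < y → 0# < x + y
  +-pos {x} {y} 0<x 0<y =
    <-trans 0<y (<-respˡ-≈ (+-identityˡ y) (+-monoˡ-< y 0<x))

  sum-pos : ∀ {n} (f : Fin (suc n) → Carrier) → (∀ i → 0# < f i) → 0# < sum f
  sum-pos {zero}  f 0<f = <-respʳ-≈ (sym (+-identityʳ (f zero))) (0<f zero)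
  sum-pos {suc n} f 0<f = +-pos (0<f zero) (sum-pos (λ i → f (suc i)) (λ i → 0<f (suc i)))

  fromℕ#-pos : ∀ n → 0# < fromℕ# (suc n)
  fromℕ#-pos zero    = <-respʳ-≈ (sym (+-identityʳ 1#)) 0<1
  fromℕ#-pos (suc n) = +-pos 0<1 (fromℕ#-pos n)

  1/_ : ∀ n .{{_ : NonZero n}} → Carrier
  1/ suc n = proj₁ (inverse (fromℕ#-pos n))

  mean : ∀ {n} .{{_ : NonZero n}} → (Fin n → Carrier) → Carrier
  mean {n} f = sum f * 1/ n

  mean-pos : ∀ {n} .{{_ : NonZero n}} (f : Fin n → Carrier) → (∀ i → 0# < f i) → 0# < mean f
  mean-pos {suc n} f 0<f = *-pos (sum-pos f 0<f) (proj₁ (proj₂ (inverse (fromℕ#-pos n))))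

  IsMinimumOf : ∀ {n} → Carrier → (Fin n → Carrier) → Set (ℓ₁ ⊔ ℓ₂)
  IsMinimumOf m f = (∃[ i ] f i ≈ m) × (∀ i → m ≤ f i)

  IsMaximumOf : ∀ {n} → Carrier → (Fin n → Carrier) → Set (ℓ₁ ⊔ ℓ₂)
  IsMaximumOf m f = (∃[ i ] f i ≈ m) × (∀ i → f i ≤ m)

record Graph : Set₁ where
  field
    order       : ℕ
    {{order≢0}} : NonZero order

  V : Set
  V = Fin order

  field
    Adj        : Rel V Level.zero
    adj?       : Decidable Adj
    adj-sym    : Symmetric Adj
    adj-irrefl : Irreflexive _≡_ Adj

  N : V → Pred V Level.zero
  N v = Adj v

  data Walk : V → V → ℕ → Set where
    []  : ∀ {u} → Walk u u 0
    _∷_ : ∀ {u v w d} → Adj u v → Walk v w d → Walk u w (suc d)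

  Connected : Set
  Connected = ∀ u v → ∃[ d ] Walk u v d

  -- d = d_G(u,v), the length of a shortest walk
  IsDistance : V → V → ℕ → Set
  IsDistance u v d = Walk u v d × (∀ d′ → Walk u v d′ → d ℕ.≤ d′)

  -- A hair w₀, …, w_{k+1}.  Its vertices are required to be distinct: otherwise
  -- the neighbourhood conditions would also allow a, b, a, b, … on a single edge.
  record IsHair {k : ℕ} (w : Fin (suc (suc k)) → V) : Set where
    field
      distinct : Injective _≡_ _≡_ w
      interior : ∀ (i : Fin k) →
                 N (w (suc (inject₁ i))) ≐ ｛ w (inject₁ (inject₁ i)) ｝ ∪ ｛ w (suc (suc i)) ｝
      end      : N (w (fromℕ (suc k))) ≐ ｛ w (inject₁ (fromℕ k)) ｝

module LipschitzFunctions {c ℓ₁ ℓ₂ : Level} (ℛ : Reals c ℓ₁ ℓ₂) (G : Graph) where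
  open Reals ℛ
  open Graph G

  Lipschitz : (V → Carrier) → Set ℓ₂
  Lipschitz X = ∀ u v d → IsDistance u v d → ∣ X u - X v ∣≤ fromℕ# d

  𝔼 : (V → Carrier) → Carrier
  𝔼 = mean

  L : (V → Carrier) → Carrier → Carrier
  L X t = ln (𝔼 e^) (mean-pos e^ (λ v → exp-pos (t * (X v - 𝔼 X))))
    where
    e^ : V → Carrier
    e^ v = exp (t * (X v - 𝔼 X))

  -- ℓ = L_G(t)
  IsMaxLogMoment : Carrier → Carrier → Set (c ⊔ ℓ₁ ⊔ ℓ₂)
  IsMaxLogMoment t ℓ = (∃[ X ] (Lipschitz X × L X t ≈ ℓ)) × (∀ X → Lipschitz X → L X t ≤ ℓ)

  Optimal : Carrier → (V → Carrier) → Set (c ⊔ ℓ₁ ⊔ ℓ₂)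
  Optimal t X = Lipschitz X × IsMaxLogMoment t (L X t)

{-# OPTIONS --safe #-}
module Submission where

-- At an optimal X, a displacement ξ for which X + ξ is Lipschitz up to a
-- permutation of the vertices (which preserves log-moments) satisfies, with
-- Z = exp (t (X - 𝔼 X)),
--     ∑ Z (1 + t (ξ - 𝔼 ξ)) ≤ ∑ Z exp (t (ξ - 𝔼 ξ)) ≤ ∑ Z,
-- the first inequality being strict unless ξ is constant.  So, for nonconstant
-- χ, no positive and negative multiples of χ are both such displacements.
-- Take for χ the indicator of {w₁, …, w_{k+1}}.  The set can be translated as
-- long as the first step s of the hair stays in [-1, 1]; hence s is 1 or -1.
-- If all later steps equal d, reflecting the values at X (w₁) is, up to
-- reversing the order of the set, a translation by - k d; hence s ≠ d would
-- permit translations in both directions.  The lemma follows by induction on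
-- the length of the hair.

open import Algebra.Bundles using (CommutativeRing)
open import Algebra.Solver.Ring.AlmostCommutativeRing using (fromCommutativeRing; _-Raw-AlmostCommutative⟶_)
open import Data.Fin.Base using (Fin; zero; suc; toℕ; inject₁; opposite)
open import Data.Fin.Induction using (<-weakInduction)
open import Data.Fin.Permutation using (Permutation′; permutation; _⟨$⟩ʳ_)
open import Data.Fin.Properties
  using (any?; _≟_; opposite-involutive; opposite-prop; suc-injective; toℕ-inject₁; toℕ≤pred[n])
open import Data.Fin.Relation.Unary.Top using (view; ‵fromℕ; ‵inject₁)
open import Data.Integer.Base as ℤ using (ℤ; -[1+_]; _⊖_)
import Data.Integer.Properties as ℤ
open import Data.Maybe.Base using (Maybe; map)
open import Data.Nat.Base as ℕ using (ℕ; zero; suc; _∸_; NonZero)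
open import Data.Nat.Properties using (m+[n∸m]≡n)
open import Data.Product.Base using (∃-syntax; _×_; _,_; proj₁; proj₂)
open import Data.Sum.Base using (_⊎_; inj₁; inj₂)
open import Data.Vec.Functional using (replicate) renaming (_∷_ to _◂_)
open import Defs
open import Function.Base using (_∘_; id)
open import Function.Definitions using (Injective)
open import Level using (Level; _⊔_)
open import Relation.Binary.PropositionalEquality.Core as ≡ using (_≡_; _≢_)
open import Relation.Binary.Structures using (IsPreorder; IsStrictPartialOrder)
open import Relation.Nullary.Decidable.Core using (Dec; yes; no; dec⇒maybe)
open import Relation.Nullary.Negation.Core using (¬_; contradiction)

-- A ring solver with integer coefficients for commutative rings.

module IntegerCoefficientSolver {c ℓ} (R : CommutativeRing c ℓ) where
  open CommutativeRing R renaming (zero to *-zero)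
  open import Algebra.Properties.AbelianGroup +-abelianGroup
    using (⁻¹-involutive; ε⁻¹≈ε; ⁻¹-∙-comm; xyx⁻¹≈y)
  open import Algebra.Properties.Ring ring using (-‿distribˡ-*; -‿distribʳ-*)
  open import Algebra.Properties.Semiring.Mult.TCOptimised semiring
    using (1+×; ×-homo-+; ×1-homo-*) renaming (_×_ to _×′_)
  open import Relation.Binary.Reasoning.Setoid setoid

  -- With the optimised multiple `×′`, the integers 0 and 1 evaluate definitionally to `0#` and
  -- `1#`, so the constants `:0` and `:1` match goals written with those literals.
  fromℤ : ℤ → Carrier
  fromℤ (ℤ.+ n)    = n ×′ 1#
  fromℤ (-[1+ n ]) = - (suc n ×′ 1#)

  fromℤ-neg : ∀ i → fromℤ (ℤ.- i) ≈ - fromℤ i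
  fromℤ-neg (ℤ.+ zero)  = sym ε⁻¹≈ε
  fromℤ-neg (ℤ.+ suc n) = refl
  fromℤ-neg (-[1+ n ])  = sym (⁻¹-involutive _)

  fromℤ-⊖ : ∀ m n → fromℤ (m ⊖ n) ≈ m ×′ 1# - n ×′ 1#
  fromℤ-⊖ m       zero    = begin
    m ×′ 1#        ≈⟨ +-identityʳ _ ⟨
    m ×′ 1# + 0#   ≈⟨ +-congˡ ε⁻¹≈ε ⟨
    m ×′ 1# - 0#   ∎
  fromℤ-⊖ zero    (suc n) = sym (+-identityˡ _)
  fromℤ-⊖ (suc m) (suc n) = begin
    fromℤ (suc m ⊖ suc n)              ≡⟨ ≡.cong fromℤ (ℤ.[1+m]⊖[1+n]≡m⊖n m n) ⟩
    fromℤ (m ⊖ n)                      ≈⟨ fromℤ-⊖ m n ⟩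
    m ×′ 1# - n ×′ 1#                    ≈⟨ +-congʳ (xyx⁻¹≈y 1# _) ⟨
    1# + m ×′ 1# - 1# - n ×′ 1#          ≈⟨ +-assoc _ _ _ ⟩
    1# + m ×′ 1# + (- 1# - n ×′ 1#)      ≈⟨ +-congˡ (⁻¹-∙-comm _ _) ⟩
    1# + m ×′ 1# - (1# + n ×′ 1#)        ≈⟨ +-cong (1+× m 1#) (-‿cong (1+× n 1#)) ⟨
    suc m ×′ 1# - suc n ×′ 1#            ∎

  fromℤ-+ : ∀ i j → fromℤ (i ℤ.+ j) ≈ fromℤ i + fromℤ j
  fromℤ-+ (ℤ.+ m)    (ℤ.+ n)    = ×-homo-+ 1# m n
  fromℤ-+ (ℤ.+ m)    (-[1+ n ]) = fromℤ-⊖ m (suc n)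
  fromℤ-+ (-[1+ m ]) (ℤ.+ n)    = trans (fromℤ-⊖ n (suc m)) (+-comm _ _)
  fromℤ-+ (-[1+ m ]) (-[1+ n ]) = begin
    - (suc (suc m ℕ.+ n) ×′ 1#)         ≈⟨ -‿cong (1+× (suc m ℕ.+ n) 1#) ⟩
    - (1# + (suc m ℕ.+ n) ×′ 1#)        ≈⟨ -‿cong (+-congˡ (×-homo-+ 1# (suc m) n)) ⟩
    - (1# + (suc m ×′ 1# + n ×′ 1#))     ≈⟨ -‿cong (+-assoc _ _ _) ⟨
    - (1# + suc m ×′ 1# + n ×′ 1#)       ≈⟨ -‿cong (+-congʳ (+-comm _ _)) ⟩
    - (suc m ×′ 1# + 1# + n ×′ 1#)       ≈⟨ -‿cong (+-assoc _ _ _) ⟩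
    - (suc m ×′ 1# + (1# + n ×′ 1#))     ≈⟨ -‿cong (+-congˡ (1+× n 1#)) ⟨
    - (suc m ×′ 1# + suc n ×′ 1#)        ≈⟨ ⁻¹-∙-comm _ _ ⟨
    - (suc m ×′ 1#) - suc n ×′ 1#        ∎

  fromℤ-+* : ∀ m j → fromℤ (ℤ.+ m ℤ.* j) ≈ m ×′ 1# * fromℤ j
  fromℤ-+* m (ℤ.+ n)    = begin
    fromℤ (ℤ.+ m ℤ.* ℤ.+ n)   ≡⟨ ≡.cong fromℤ (ℤ.pos-* m n) ⟨
    (m ℕ.* n) ×′ 1#            ≈⟨ ×1-homo-* m n ⟩
    m ×′ 1# * n ×′ 1#           ∎
  fromℤ-+* m (-[1+ n ]) = begin
    fromℤ (ℤ.+ m ℤ.* ℤ.- ℤ.+ suc n)     ≡⟨ ≡.cong fromℤ (ℤ.neg-distribʳ-* (ℤ.+ m) (ℤ.+ suc n)) ⟨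
    fromℤ (ℤ.- (ℤ.+ m ℤ.* ℤ.+ suc n))   ≈⟨ fromℤ-neg (ℤ.+ m ℤ.* ℤ.+ suc n) ⟩
    - fromℤ (ℤ.+ m ℤ.* ℤ.+ suc n)       ≈⟨ -‿cong (fromℤ-+* m (ℤ.+ suc n)) ⟩
    - (m ×′ 1# * suc n ×′ 1#)             ≈⟨ -‿distribʳ-* _ _ ⟩
    m ×′ 1# * - (suc n ×′ 1#)             ∎

  fromℤ-* : ∀ i j → fromℤ (i ℤ.* j) ≈ fromℤ i * fromℤ j
  fromℤ-* (ℤ.+ m)    j = fromℤ-+* m j
  fromℤ-* (-[1+ m ]) j = begin
    fromℤ (ℤ.- ℤ.+ suc m ℤ.* j)      ≡⟨ ≡.cong fromℤ (ℤ.neg-distribˡ-* (ℤ.+ suc m) j) ⟨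
    fromℤ (ℤ.- (ℤ.+ suc m ℤ.* j))    ≈⟨ fromℤ-neg (ℤ.+ suc m ℤ.* j) ⟩
    - fromℤ (ℤ.+ suc m ℤ.* j)        ≈⟨ -‿cong (fromℤ-+* (suc m) j) ⟩
    - (suc m ×′ 1# * fromℤ j)         ≈⟨ -‿distribˡ-* _ _ ⟩
    - (suc m ×′ 1#) * fromℤ j         ∎

  morphism : ℤ.+-*-rawRing -Raw-AlmostCommutative⟶ fromCommutativeRing R
  morphism = record
    { ⟦_⟧    = fromℤ
    ; +-homo = fromℤ-+
    ; *-homo = fromℤ-*
    ; -‿homo = fromℤ-neg
    ; 0-homo = refl
    ; 1-homo = refl
    }

  -- Coefficients are compared as integers, where equality is decidable; equality in the ring need
  -- not be.
  equal? : ∀ i j → Maybe (fromℤ i ≈ fromℤ j)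
  equal? i j = map (λ i≡j → reflexive (≡.cong fromℤ i≡j)) (dec⇒maybe (i ℤ.≟ j))

  open import Algebra.Solver.Ring ℤ.+-*-rawRing (fromCommutativeRing R) morphism equal? public
    using (solve; _:=_; _:+_; _:*_; _:-_; :-_; Polynomial)
  open import Algebra.Solver.Ring ℤ.+-*-rawRing (fromCommutativeRing R) morphism equal?
    using (con)

  :0 :1 : ∀ {n} → Polynomial n
  :0 = con (ℤ.+ 0)
  :1 = con (ℤ.+ 1)

-- Order, exponential, sums and means over the constructive reals.

module RealProperties {c ℓ₁ ℓ₂} (ℛ : Reals c ℓ₁ ℓ₂) where
  open Reals ℛ
  open IsStrictPartialOrder <-isStrictPartialOrder using (irrefl; asym; <-resp-≈)
  open IntegerCoefficientSolver commutativeRing public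
    using (solve; _:=_; _:+_; _:*_; _:-_; :-_; :0; :1)

  <⇒≤ : ∀ {x y} → x < y → x ≤ y
  <⇒≤ = asym

  ≤-reflexive : ∀ {x y} → x ≈ y → x ≤ y
  ≤-reflexive x≈y = irrefl (sym x≈y)

  -- Since `≤` is only the negation of the reversed `<`, cotransitivity takes the place of
  -- trichotomy: of its two alternatives, the hypothesis refutes one.
  ≤-<-trans : ∀ {x y z} → x ≤ y → y < z → x < z
  ≤-<-trans {x} x≤y y<z with <-cotransitive y<z x
  ... | inj₁ y<x = contradiction y<x x≤y
  ... | inj₂ x<z = x<z

  <-≤-trans : ∀ {x y z} → x < y → y ≤ z → x < z
  <-≤-trans {z = z} x<y y≤z with <-cotransitive x<y z
  ... | inj₁ x<z = x<z
  ... | inj₂ z<y = contradiction z<y y≤z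

  ≤-trans : ∀ {x y z} → x ≤ y → y ≤ z → x ≤ z
  ≤-trans x≤y y≤z z<x = x≤y (≤-<-trans y≤z z<x)

  ≤-isPreorder : IsPreorder _≈_ _≤_
  ≤-isPreorder = record { isEquivalence = isEquivalence ; reflexive = ≤-reflexive ; trans = ≤-trans }

  module ≤-Reasoning where
    open import Relation.Binary.Reasoning.Base.Triple
      ≤-isPreorder asym <-trans <-resp-≈ <⇒≤ <-≤-trans ≤-<-trans public

  open ≤-Reasoning

  x<y⇒0<y-x : ∀ {x y} → x < y → 0# < y - x
  x<y⇒0<y-x {x} x<y = <-respˡ-≈ (-‿inverseʳ x) (+-monoˡ-< (- x) x<y)

  0<y-x⇒x<y : ∀ {x y} → 0# < y - x → x < y
  0<y-x⇒x<y {x} {y} 0<y-x = begin-strict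
    x            ≈⟨ +-identityˡ x ⟨
    0# + x       <⟨ +-monoˡ-< x 0<y-x ⟩
    y - x + x    ≈⟨ solve 2 (λ x y → y :- x :+ x := y) refl x y ⟩
    y            ∎

  +-cancelʳ-< : ∀ {x y} z → x + z < y + z → x < y
  +-cancelʳ-< {x} {y} z x+z<y+z = 0<y-x⇒x<y (<-respʳ-≈
    (solve 3 (λ x y z → (y :+ z) :- (x :+ z) := y :- x) refl x y z) (x<y⇒0<y-x x+z<y+z))

  +-monoˡ-≤ : ∀ {x y} z → x ≤ y → x + z ≤ y + z
  +-monoˡ-≤ z x≤y y+z<x+z = x≤y (+-cancelʳ-< z y+z<x+z)

  +-monoʳ-≤ : ∀ {x y} z → x ≤ y → z + x ≤ z + y
  +-monoʳ-≤ {x} {y} z x≤y = begin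
    z + x  ≈⟨ +-comm z x ⟩
    x + z  ≤⟨ +-monoˡ-≤ z x≤y ⟩
    y + z  ≈⟨ +-comm y z ⟩
    z + y  ∎

  +-monoʳ-< : ∀ {x y} z → x < y → z + x < z + y
  +-monoʳ-< {x} {y} z x<y = begin-strict
    z + x  ≈⟨ +-comm z x ⟩
    x + z  <⟨ +-monoˡ-< z x<y ⟩
    y + z  ≈⟨ +-comm y z ⟩
    z + y  ∎

  +-mono-≤ : ∀ {x y u v} → x ≤ y → u ≤ v → x + u ≤ y + v
  +-mono-≤ {y = y} {u = u} x≤y u≤v = ≤-trans (+-monoˡ-≤ u x≤y) (+-monoʳ-≤ y u≤v)

  *-monoʳ-< : ∀ {x y z} → 0# < z → x < y → z * x < z * y
  *-monoʳ-< {x} {y} {z} 0<z x<y = 0<y-x⇒x<y (<-respʳ-≈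
    (solve 3 (λ x y z → z :* (y :- x) := z :* y :- z :* x) refl x y z)
    (*-pos 0<z (x<y⇒0<y-x x<y)))

  *-cancelˡ-< : ∀ {x y z} → 0# < z → z * x < z * y → x < y
  *-cancelˡ-< {x} {y} {z} 0<z zx<zy with inverse 0<z
  ... | z⁻¹ , 0<z⁻¹ , zz⁻¹≈1 = begin-strict
    x               ≈⟨ cancel x ⟨
    z⁻¹ * (z * x)   <⟨ *-monoʳ-< 0<z⁻¹ zx<zy ⟩
    z⁻¹ * (z * y)   ≈⟨ cancel y ⟩
    y               ∎
    where
    cancel : ∀ a → z⁻¹ * (z * a) ≈ a
    cancel a = trans (solve 3 (λ i z a → i :* (z :* a) := z :* i :* a) refl z⁻¹ z a)
      (trans (*-congʳ zz⁻¹≈1) (*-identityˡ a))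

  *-monoʳ-≤ : ∀ {x y z} → 0# < z → x ≤ y → z * x ≤ z * y
  *-monoʳ-≤ 0<z x≤y zy<zx = x≤y (*-cancelˡ-< 0<z zy<zx)

  -- Applied below to the derivatives along two opposite displacements, whose weighted sum vanishes
  -- by linearity.
  positive-combination≉0 : ∀ {a b x y} → 0# < a → 0# < b → x < 0# → y ≤ 0# → ¬ (a * x + b * y ≈ 0#)
  positive-combination≉0 {a} {b} {x} {y} 0<a 0<b x<0 y≤0 sum≈0 = irrefl sum≈0 (begin-strict
    a * x + b * y     <⟨ +-monoˡ-< (b * y) (*-monoʳ-< 0<a x<0) ⟩
    a * 0# + b * y    ≤⟨ +-monoʳ-≤ (a * 0#) (*-monoʳ-≤ 0<b y≤0) ⟩
    a * 0# + b * 0#   ≈⟨ solve 2 (λ a b → a :* :0 :+ b :* :0 := :0) refl a b ⟩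
    0#                ∎)

  neg-mono-< : ∀ {x y} → x < y → - y < - x
  neg-mono-< {x} {y} x<y = 0<y-x⇒x<y (<-respʳ-≈
    (solve 2 (λ x y → y :- x := :- x :- :- y) refl x y) (x<y⇒0<y-x x<y))

  neg-mono-≤ : ∀ {x y} → x ≤ y → - y ≤ - x
  neg-mono-≤ {x} {y} x≤y -x<-y = x≤y (+-cancelʳ-< (- x - y) (begin-strict
    y + (- x - y)   ≈⟨ solve 2 (λ x y → y :+ (:- x :- y) := :- x) refl x y ⟩
    - x             <⟨ -x<-y ⟩
    - y             ≈⟨ solve 2 (λ x y → x :+ (:- x :- y) := :- y) refl x y ⟨
    x + (- x - y)   ∎))

  ∣∣≤-cong : ∀ {x y d} → x ≈ y → ∣ x ∣≤ d → ∣ y ∣≤ d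
  ∣∣≤-cong x≈y (-d≤x , x≤d) =
    ≤-trans -d≤x (≤-reflexive x≈y) , ≤-trans (≤-reflexive (sym x≈y)) x≤d

  ∣-∣≤ : ∀ {x d} → ∣ x ∣≤ d → ∣ - x ∣≤ d
  ∣-∣≤ {x} {d} (-d≤x , x≤d) = neg-mono-≤ x≤d , (begin
    - x       ≤⟨ neg-mono-≤ -d≤x ⟩
    - (- d)   ≈⟨ solve 1 (λ d → :- (:- d) := d) refl d ⟩
    d         ∎)

  -- Factor `exp y` as `exp x * exp (y - x)`; the second factor is at least `1# + (y - x)`, hence at
  -- least 1.
  exp-mono-≤ : ∀ {x y} → x ≤ y → exp x ≤ exp y
  exp-mono-≤ {x} {y} x≤y = begin
    exp x                   ≈⟨ solve 2 (λ e x → e := e :* (:1 :+ (x :- x))) refl (exp x) x ⟩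
    exp x * (1# + (x - x))  ≤⟨ *-monoʳ-≤ (exp-pos x) (+-monoʳ-≤ 1# (+-monoˡ-≤ (- x) x≤y)) ⟩
    exp x * (1# + (y - x))  ≤⟨ *-monoʳ-≤ (exp-pos x) (1+x≤expx (y - x)) ⟩
    exp x * exp (y - x)     ≈⟨ exp-+ x (y - x) ⟨
    exp (x + (y - x))       ≈⟨ exp-cong (solve 2 (λ x y → x :+ (y :- x) := y) refl x y) ⟩
    exp y                   ∎

  ln-cancel-≤ : ∀ {x y} (0<x : 0# < x) (0<y : 0# < y) → ln x 0<x ≤ ln y 0<y → x ≤ y
  ln-cancel-≤ {x} {y} 0<x 0<y lnx≤lny = begin
    x                ≈⟨ exp-ln x 0<x ⟨
    exp (ln x 0<x)   ≤⟨ exp-mono-≤ lnx≤lny ⟩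
    exp (ln y 0<y)   ≈⟨ exp-ln y 0<y ⟩
    y                ∎

  -- Squaring 1 + x/2 ≤ exp (x/2) gains the term (x/2)².
  1+x<expx : ∀ {x} → 0# < x → 1# + x < exp x
  1+x<expx {x} 0<x with inverse (fromℕ#-pos 1)
  ... | ½ , 0<½ , 2½≈1 = begin-strict
    1# + x                  ≈⟨ +-congˡ (trans (*-congʳ 2½≈1) (*-identityˡ x)) ⟨
    1# + fromℕ# 2 * ½ * x   ≈⟨ solve 2 (λ x ½ → :1 :+ (:1 :+ (:1 :+ :0)) :* ½ :* x
                                := :1 :+ (½ :* x :+ ½ :* x) :+ :0) refl x ½ ⟩
    1# + (h + h) + 0#       <⟨ +-monoʳ-< _ (*-pos 0<h 0<h) ⟩
    1# + (h + h) + h * h    ≈⟨ solve 1 (λ h → :1 :+ (h :+ h) :+ h :* h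
                                := (:1 :+ h) :* (:1 :+ h)) refl h ⟩
    (1# + h) * (1# + h)     ≤⟨ *-monoʳ-≤ (+-pos 0<1 0<h) (1+x≤expx h) ⟩
    (1# + h) * exp h        ≈⟨ *-comm _ _ ⟩
    exp h * (1# + h)        ≤⟨ *-monoʳ-≤ (exp-pos h) (1+x≤expx h) ⟩
    exp h * exp h           ≈⟨ exp-+ h h ⟨
    exp (h + h)             ≈⟨ exp-cong (solve 2 (λ x ½ → (:1 :+ (:1 :+ :0)) :* ½ :* x
                                := ½ :* x :+ ½ :* x) refl x ½) ⟨
    exp (fromℕ# 2 * ½ * x)  ≈⟨ exp-cong (trans (*-congʳ 2½≈1) (*-identityˡ x)) ⟩
    exp x                   ∎
    where
    h = ½ * x
    0<h = *-pos 0<½ 0<x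

  open import Algebra.Properties.CommutativeMonoid.Sum +-commutativeMonoid public
    using (∑-distrib-+; sum-permute; sum-cong-≋)
  open import Algebra.Properties.Semiring.Sum semiring public
    using (*-distribˡ-sum)

  sum-mono-≤ : ∀ {n} {f g : Fin n → Carrier} → (∀ i → f i ≤ g i) → sum f ≤ sum g
  sum-mono-≤ {zero}  f≤g = ≤-reflexive refl
  sum-mono-≤ {suc n} f≤g = +-mono-≤ (f≤g zero) (sum-mono-≤ (f≤g ∘ suc))

  sum-mono-< : ∀ {n} {f g : Fin n → Carrier} → (∀ i → f i ≤ g i) → (∃[ i ] f i < g i) → sum f < sum g
  sum-mono-< f≤g (zero  , f<g) = <-≤-trans (+-monoˡ-< _ f<g) (+-monoʳ-≤ _ (sum-mono-≤ (f≤g ∘ suc)))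
  sum-mono-< f≤g (suc i , f<g) = ≤-<-trans (+-monoˡ-≤ _ (f≤g zero)) (+-monoʳ-< _ (sum-mono-< (f≤g ∘ suc) (i , f<g)))

  1/-pos : ∀ n .{{_ : NonZero n}} → 0# < 1/ n
  1/-pos (suc n) = proj₁ (proj₂ (inverse (fromℕ#-pos n)))

  mean-cancel-≤ : ∀ {n} .{{_ : NonZero n}} {f g : Fin n → Carrier} → mean f ≤ mean g → sum f ≤ sum g
  mean-cancel-≤ {n} {f} {g} f≤g sumg<sumf = f≤g (begin-strict
    sum g * 1/ n   ≈⟨ *-comm _ _ ⟩
    1/ n * sum g   <⟨ *-monoʳ-< (1/-pos n) sumg<sumf ⟩
    1/ n * sum f   ≈⟨ *-comm _ _ ⟩
    sum f * 1/ n   ∎)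

  mean-cong : ∀ {n} .{{_ : NonZero n}} {f g : Fin n → Carrier} → (∀ i → f i ≈ g i) → mean f ≈ mean g
  mean-cong f≈g = *-congʳ (sum-cong-≋ f≈g)

  mean-distrib-+ : ∀ {n} .{{_ : NonZero n}} (f g : Fin n → Carrier) →
                   mean (λ i → f i + g i) ≈ mean f + mean g
  mean-distrib-+ f g = trans (*-congʳ (∑-distrib-+ f g)) (distribʳ _ _ _)

  mean-permute : ∀ {n} .{{_ : NonZero n}} (f : Fin n → Carrier) (π : Permutation′ n) →
                 mean f ≈ mean (λ i → f (π ⟨$⟩ʳ i))
  mean-permute f π = *-congʳ (sum-permute f π)

  *-distribˡ-mean : ∀ {n} .{{_ : NonZero n}} x (f : Fin n → Carrier) →
                    x * mean f ≈ mean (λ i → x * f i)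
  *-distribˡ-mean {n} x f = trans (sym (*-assoc x (sum f) (1/ n))) (*-congʳ (*-distribˡ-sum x f))

-- Overwriting a function along a family of points, and extending involutions.

module _ {k n : ℕ} (w : Fin k → Fin n) where

  -- The search returns some index of `v`; injectivity of `w`, assumed only afterwards, makes the
  -- value independent of that choice.
  overwrite : ∀ {a} {A : Set a} → (Fin k → A) → (Fin n → A) → Fin n → A
  overwrite g f v with any? (λ j → w j ≟ v)
  ... | yes (j , _) = g j
  ... | no  _       = f v

  module _ (w-injective : Injective _≡_ _≡_ w) {a} {A : Set a} (g : Fin k → A) (f : Fin n → A) where

    overwrite-∈ : ∀ j → overwrite g f (w j) ≡ g j
    overwrite-∈ j with any? (λ i → w i ≟ w j)
    ... | yes (i , wi≡wj) = ≡.cong g (w-injective wi≡wj)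
    ... | no  ∉           = contradiction (j , ≡.refl) ∉

    overwrite-∉ : ∀ {v} → ¬ (∃[ j ] w j ≡ v) → overwrite g f v ≡ f v
    overwrite-∉ {v} ∉ with any? (λ i → w i ≟ v)
    ... | yes ∈ = contradiction ∈ ∉
    ... | no  _ = ≡.refl

  module _ (w-injective : Injective _≡_ _≡_ w) (ρ : Fin k → Fin k) (ρ-involutive : ∀ j → ρ (ρ j) ≡ j) where

    private
      extension = overwrite (w ∘ ρ) id
      extension-∈ = overwrite-∈ w-injective (w ∘ ρ) id
      extension-∉ = overwrite-∉ w-injective (w ∘ ρ) id

    extension-involutive : ∀ v → extension (extension v) ≡ v
    extension-involutive v with any? (λ j → w j ≟ v)
    ... | yes (j , ≡.refl) = ≡.trans (extension-∈ (ρ j)) (≡.cong w (ρ-involutive j))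
    ... | no  ∉            = extension-∉ ∉

    -- Acts as `ρ` on the points of `w` and fixes all others. Being an involution, it serves as its
    -- own inverse.
    extend : Permutation′ n
    extend = permutation extension extension extension-involutive extension-involutive

-- First-order variation of the log-moment at an optimal function.

module Variations {c ℓ₁ ℓ₂} (ℛ : Reals c ℓ₁ ℓ₂) (G : Graph) where
  open Reals ℛ
  open RealProperties ℛ
  open Graph G
  open LipschitzFunctions ℛ G
  open ≤-Reasoning

  -- Only the rearrangement `X′` has to be Lipschitz; `X + ξ` itself may fail to be.
  Reachable : (V → Carrier) → (V → Carrier) → Set (c ⊔ ℓ₁ ⊔ ℓ₂)
  Reachable X ξ =
    ∃[ X′ ] (Lipschitz X′ × (∃[ π ] (∀ v → X′ (π ⟨$⟩ʳ v) ≈ X v + ξ v)))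

  module _ {t : Carrier} (0<t : 0# < t) {X : V → Carrier} (X-optimal : Optimal t X) where

    weight : V → Carrier
    weight v = exp (t * (X v - 𝔼 X))

    exponent : (V → Carrier) → V → Carrier
    exponent ξ v = t * (ξ v - 𝔼 ξ)

    -- The derivative at r = 0 of the sum of `weight v * exp (r * exponent ξ v)`; up to a positive
    -- factor, that of the log-moment of X + rξ. It is linear in `ξ`.
    derivative : (V → Carrier) → Carrier
    derivative ξ = sum (λ v → weight v * exponent ξ v)

    -- This is the maximality of the log-moment of `X` against `X′`, stripped of `ln` and of the
    -- factor 1/n. Means are invariant under permutations, so centring `X′` amounts to centring `X`
    -- and `ξ` separately, and the exponential factors.
    reachable⇒sum≤ : ∀ {ξ} → Reachable X ξ → sum (λ v → weight v * exp (exponent ξ v)) ≤ sum weight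
    reachable⇒sum≤ {ξ} (X′ , X′-lipschitz , π , X′π≈X+ξ) = mean-cancel-≤ (begin
      𝔼 (λ v → weight v * exp (exponent ξ v))            ≈⟨ mean-cong weight′ ⟨
      𝔼 (λ v → exp (t * (X′ (π ⟨$⟩ʳ v) - 𝔼 X′)))         ≈⟨ mean-permute (λ v → exp (t * (X′ v - 𝔼 X′))) π ⟨
      𝔼 (λ v → exp (t * (X′ v - 𝔼 X′)))                  ≤⟨ ln-cancel-≤ _ _ (proj₂ (proj₂ X-optimal) X′ X′-lipschitz) ⟩
      𝔼 weight                                           ∎)
      where
      𝔼X′≈ : 𝔼 X′ ≈ 𝔼 X + 𝔼 ξ
      𝔼X′≈ = trans (mean-permute X′ π) (trans (mean-cong X′π≈X+ξ) (mean-distrib-+ X ξ))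

      weight′ : ∀ v → exp (t * (X′ (π ⟨$⟩ʳ v) - 𝔼 X′)) ≈ weight v * exp (exponent ξ v)
      weight′ v = trans (exp-cong (trans
        (*-congˡ (+-cong (X′π≈X+ξ v) (-‿cong 𝔼X′≈)))
        (solve 5 (λ t x ξ m n → t :* (x :+ ξ :- (m :+ n)) := t :* (x :- m) :+ t :* (ξ :- n)) refl
          t (X v) (ξ v) (𝔼 X) (𝔼 ξ))))
        (exp-+ _ _)

    sum+derivative : ∀ ξ → sum weight + derivative ξ ≈ sum (λ v → weight v * (1# + exponent ξ v))
    sum+derivative ξ = trans (sym (∑-distrib-+ weight _)) (sum-cong-≋ λ v →
      solve 2 (λ z u → z :+ z :* u := z :* (:1 :+ u)) refl (weight v) (exponent ξ v))

    linearisation : ∀ ξ v → weight v * (1# + exponent ξ v) ≤ weight v * exp (exponent ξ v)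
    linearisation ξ v = *-monoʳ-≤ (exp-pos _) (1+x≤expx (exponent ξ v))

    derivative≤0 : ∀ {ξ} → Reachable X ξ → derivative ξ ≤ 0#
    derivative≤0 {ξ} reachable 0<D = reachable⇒sum≤ reachable (begin-strict
      sum weight                                      ≈⟨ +-identityʳ _ ⟨
      sum weight + 0#                                 <⟨ +-monoʳ-< _ 0<D ⟩
      sum weight + derivative ξ                       ≈⟨ sum+derivative ξ ⟩
      sum (λ v → weight v * (1# + exponent ξ v))      ≤⟨ sum-mono-≤ (linearisation ξ) ⟩
      sum (λ v → weight v * exp (exponent ξ v))       ∎)

    -- The strict bound `1+x<expx` is for positive arguments, so nonconstancy enters through a
    -- vertex where `ξ` exceeds its mean; one strict term makes the whole sum strict.
    derivative<0 : ∀ {ξ} → Reachable X ξ → (∃[ v ] 0# < ξ v - 𝔼 ξ) → derivative ξ < 0#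
    derivative<0 {ξ} reachable (v , 0<c) = +-cancelʳ-< (sum weight) (begin-strict
      derivative ξ + sum weight                       ≈⟨ +-comm _ _ ⟩
      sum weight + derivative ξ                       ≈⟨ sum+derivative ξ ⟩
      sum (λ v → weight v * (1# + exponent ξ v))      <⟨ sum-mono-< (linearisation ξ)
                                                           (v , *-monoʳ-< (exp-pos _) (1+x<expx (*-pos 0<t 0<c))) ⟩
      sum (λ v → weight v * exp (exponent ξ v))       ≤⟨ reachable⇒sum≤ reachable ⟩
      sum weight                                      ≈⟨ +-identityˡ _ ⟨
      0# + sum weight                                 ∎)

    centred-* : ∀ x χ v → x * χ v - 𝔼 (λ v → x * χ v) ≈ x * (χ v - 𝔼 χ)
    centred-* x χ v = trans (+-congˡ (-‿cong (sym (*-distribˡ-mean x χ))))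
      (solve 3 (λ x a b → x :* a :- x :* b := x :* (a :- b)) refl x (χ v) (𝔼 χ))

    derivative-* : ∀ x χ → derivative (λ v → x * χ v) ≈ x * derivative χ
    derivative-* x χ = trans (sum-cong-≋ λ v → trans (*-congˡ (*-congˡ (centred-* x χ v)))
        (solve 4 (λ z t x y → z :* (t :* (x :* y)) := x :* (z :* (t :* y))) refl (weight v) t x _))
      (sym (*-distribˡ-sum x (λ v → weight v * exponent χ v)))

    -- By linearity, β times the derivative along αχ plus α times that along -βχ is 0. Optimality
    -- makes both derivatives at most 0, and one of them negative.
    not-both-directions : ∀ {χ a b α β} → χ b < χ a → 0# < α → 0# < β →
      Reachable X (λ v → α * χ v) → ¬ Reachable X (λ v → - β * χ v)
    not-both-directions {χ} {a} {b} {α} {β} χb<χa 0<α 0<β up down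
      -- Either `χ a` exceeds the mean, and the displacement `up` is strict at `a`, or `χ b` lies
      -- below it, and `down` is strict at `b`.
      with <-cotransitive (+-monoˡ-< (- 𝔼 χ) χb<χa) 0#
    ... | inj₂ 0<χa-𝔼χ = positive-combination≉0 0<β 0<α
      (derivative<0 up (a , (begin-strict
        0#                                  <⟨ *-pos 0<α 0<χa-𝔼χ ⟩
        α * (χ a - 𝔼 χ)                     ≈⟨ centred-* α χ a ⟨
        α * χ a - 𝔼 (λ v → α * χ v)         ∎)))
      (derivative≤0 down)
      balance
      where
      balance : β * derivative (λ v → α * χ v) + α * derivative (λ v → - β * χ v) ≈ 0#
      balance = trans (+-cong (*-congˡ (derivative-* α χ)) (*-congˡ (derivative-* (- β) χ)))
        (solve 3 (λ α β d → β :* (α :* d) :+ α :* (:- β :* d) := :0) refl α β (derivative χ))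
    ... | inj₁ χb-𝔼χ<0 = positive-combination≉0 0<α 0<β
      (derivative<0 down (b , (begin-strict
        0#                                  ≈⟨ solve 1 (λ β → :0 := β :* :- :0) refl β ⟩
        β * (- 0#)                          <⟨ *-monoʳ-< 0<β (neg-mono-< χb-𝔼χ<0) ⟩
        β * (- (χ b - 𝔼 χ))                 ≈⟨ solve 2 (λ β x → β :* :- x := :- β :* x) refl β (χ b - 𝔼 χ) ⟩
        - β * (χ b - 𝔼 χ)                   ≈⟨ centred-* (- β) χ b ⟨
        - β * χ b - 𝔼 (λ v → - β * χ v)     ∎)))
      (derivative≤0 up)
      balance
      where
      balance : α * derivative (λ v → - β * χ v) + β * derivative (λ v → α * χ v) ≈ 0#
      balance = trans (+-cong (*-congˡ (derivative-* (- β) χ)) (*-congˡ (derivative-* α χ)))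
        (solve 3 (λ α β d → α :* (:- β :* d) :+ β :* (α :* d) := :0) refl α β (derivative χ))

-- Adjacency along a hair.

module Hairs (G : Graph) where
  open Graph G

  module _ {k : ℕ} {w : Fin (suc (suc k)) → V} (hair : IsHair w) where
    open IsHair hair

    predecessor-adjacent : ∀ (i : Fin (suc k)) → Adj (w (suc i)) (w (inject₁ i))
    predecessor-adjacent i with view i
    ... | ‵fromℕ     = proj₂ end ≡.refl
    ... | ‵inject₁ j = proj₂ (interior j) (inj₁ ≡.refl)

    -- The successor case is indexed by the edge `j` that leaves `w (suc i)`, so that every hair
    -- edge has the form `w (inject₁ j)`, `w (suc j)`.
    neighbours : ∀ (i : Fin (suc k)) {v} → Adj (w (suc i)) v →
                 w (inject₁ i) ≡ v ⊎ (∃[ j ] (suc i ≡ inject₁ j × w (suc j) ≡ v))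
    neighbours i adj with view i
    ... | ‵fromℕ     = inj₁ (proj₁ end adj)
    ... | ‵inject₁ j with proj₁ (interior j) adj
    ...   | inj₁ predecessor≡v = inj₁ predecessor≡v
    ...   | inj₂ successor≡v   = inj₂ (suc j , ≡.refl , successor≡v)

  -- `IsHair` restricts neighbourhoods only away from the root, so `w₁` can become the new root.
  -- This drives the induction on length.
  drop-root : ∀ {k} {w : Fin (suc (suc (suc k))) → V} → IsHair w → IsHair (w ∘ suc)
  drop-root hair = record
    { distinct = suc-injective ∘ distinct
    ; interior = interior ∘ suc
    ; end      = end
    }
    where open IsHair hair

-- Modifying a Lipschitz function along a hair.

module LipschitzHairs {c ℓ₁ ℓ₂} (ℛ : Reals c ℓ₁ ℓ₂) (G : Graph) where
  open Reals ℛ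
  open RealProperties ℛ
  open Graph G
  open Hairs G
  open LipschitzFunctions ℛ G
  open Variations ℛ G
  open import Algebra.Properties.Monoid.Mult +-monoid using (×-homo-+)
  open ≤-Reasoning

  adjacent⇒distance-1 : ∀ {u v} → Adj u v → IsDistance u v 1
  adjacent⇒distance-1 adj = adj ∷ [] , λ where
    zero    []  → contradiction adj (adj-irrefl ≡.refl)
    (suc d) _   → ℕ.s≤s ℕ.z≤n

  lipschitz⇒edge : ∀ {X} → Lipschitz X → ∀ {u v} → Adj u v → ∣ X u - X v ∣≤ 1#
  lipschitz⇒edge lipschitz {u} {v} adj with lipschitz u v 1 (adjacent⇒distance-1 adj)
  ... | -1≤ , ≤1 =
    ≤-trans (≤-reflexive (-‿cong (sym (+-identityʳ 1#)))) -1≤ , ≤-trans ≤1 (≤-reflexive (+-identityʳ 1#))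

  -- Edge differences telescope along a walk.
  edge⇒lipschitz : ∀ {X} → (∀ {u v} → Adj u v → ∣ X u - X v ∣≤ 1#) → Lipschitz X
  edge⇒lipschitz {X} edge u v d (walk , _) = along walk
    where
    along : ∀ {u v d} → Walk u v d → ∣ X u - X v ∣≤ fromℕ# d
    along {u} [] =
        ≤-reflexive (solve 1 (λ x → :- :0 := x :- x) refl (X u))
      , ≤-reflexive (-‿inverseʳ (X u))
    along {u} {w} {suc d} (_∷_ {v = v} adj walk) with edge adj | along walk
    ... | -1≤ , ≤1 | -d≤ , ≤d = (begin
        - (1# + fromℕ# d)         ≈⟨ solve 2 (λ x y → :- (x :+ y) := :- x :+ :- y) refl 1# (fromℕ# d) ⟩
        - 1# + - fromℕ# d         ≤⟨ +-mono-≤ -1≤ -d≤ ⟩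
        X u - X v + (X v - X w)   ≈⟨ telescope ⟩
        X u - X w                 ∎) , (begin
        X u - X w                 ≈⟨ telescope ⟨
        X u - X v + (X v - X w)   ≤⟨ +-mono-≤ ≤1 ≤d ⟩
        1# + fromℕ# d             ∎)
      where
      telescope : X u - X v + (X v - X w) ≈ X u - X w
      telescope = solve 3 (λ x y z → x :- y :+ (y :- z) := x :- z) refl (X u) (X v) (X w)

  module _ {X : V → Carrier} (X-lipschitz : Lipschitz X)
           {k : ℕ} {w : Fin (suc (suc k)) → V} (hair : IsHair w) where
    open IsHair hair

    step : Fin (suc k) → Carrier
    step i = X (w (suc i)) - X (w (inject₁ i))

    ∣step∣≤1 : ∀ i → ∣ step i ∣≤ 1#
    ∣step∣≤1 i = lipschitz⇒edge X-lipschitz (predecessor-adjacent hair i)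

    -- The hair meets the rest of the graph only at its root, where `g` agrees with `X`. So an edge
    -- either lies on the hair, where the bound on `g` applies, or avoids all `w (suc i)`, where the
    -- function is still `X`.
    overwrite-lipschitz : ∀ (g : Fin (suc (suc k)) → Carrier) → g zero ≈ X (w zero) →
      (∀ i → ∣ g (suc i) - g (inject₁ i) ∣≤ 1#) → Lipschitz (overwrite w g X)
    overwrite-lipschitz g g₀≈ ∣Δg∣≤1 = edge⇒lipschitz edge
      where
      Y : V → Carrier
      Y = overwrite w g X

      Y∈ : ∀ j → g j ≈ Y (w j)
      Y∈ j = reflexive (≡.sym (overwrite-∈ w distinct g X j))

      Y∉ : ∀ {v} → ¬ (∃[ i ] w (suc i) ≡ v) → X v ≈ Y v
      Y∉ {v} ∉ with any? (λ j → w j ≟ v)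
      ... | yes (zero  , ≡.refl) = sym g₀≈
      ... | yes (suc i , wi≡v)   = contradiction (i , wi≡v) ∉
      ... | no  _                = refl

      swap : ∀ {x y} → ∣ x - y ∣≤ 1# → ∣ y - x ∣≤ 1#
      swap {x} {y} = ∣∣≤-cong (solve 2 (λ x y → :- (x :- y) := y :- x) refl x y) ∘ ∣-∣≤

      edge-from-hair : ∀ i {v} → Adj (w (suc i)) v → ∣ Y (w (suc i)) - Y v ∣≤ 1#
      edge-from-hair i adj with neighbours hair i adj
      ... | inj₁ ≡.refl = ∣∣≤-cong (+-cong (Y∈ (suc i)) (-‿cong (Y∈ (inject₁ i)))) (∣Δg∣≤1 i)
      -- Here `w (suc i)` is the root-side end of edge `j`, so the bound for `j` is read backwards.
      ... | inj₂ (j , 1+i≡j , ≡.refl) = swap (∣∣≤-cong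
          (+-cong (Y∈ (suc j)) (-‿cong (trans (Y∈ (inject₁ j)) (reflexive (≡.cong (Y ∘ w) (≡.sym 1+i≡j))))))
          (∣Δg∣≤1 j))

      edge : ∀ {u v} → Adj u v → ∣ Y u - Y v ∣≤ 1#
      edge {u} {v} adj = cases (any? (λ i → w (suc i) ≟ u)) (any? (λ i → w (suc i) ≟ v))
        where
        cases : Dec (∃[ i ] w (suc i) ≡ u) → Dec (∃[ i ] w (suc i) ≡ v) → ∣ Y u - Y v ∣≤ 1#
        cases (yes (i , ≡.refl)) _                  = edge-from-hair i adj
        cases (no  _)            (yes (i , ≡.refl)) = swap (edge-from-hair i (adj-sym adj))
        cases (no  u∉)           (no  v∉)           =
          ∣∣≤-cong (+-cong (Y∉ u∉) (-‿cong (Y∉ v∉))) (lipschitz⇒edge X-lipschitz adj)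

    aboveRoot : Fin (suc (suc k)) → Carrier
    aboveRoot = 0# ◂ replicate (suc k) 1#

    χ : V → Carrier
    χ = overwrite w aboveRoot (λ _ → 0#)

    -- The Lipschitz bound is checked on `g` in path order, while the translated values are matched
    -- only after the rearrangement `ρ`, extended by the identity off the hair.
    overwrite-reachable : ∀ (δ : Carrier) (g : Fin (suc (suc k)) → Carrier)
      (ρ : Fin (suc (suc k)) → Fin (suc (suc k))) → (∀ j → ρ (ρ j) ≡ j) →
      g zero ≈ X (w zero) → (∀ i → ∣ g (suc i) - g (inject₁ i) ∣≤ 1#) →
      (∀ j → g (ρ j) ≈ X (w j) + δ * aboveRoot j) → Reachable X (λ v → δ * χ v)
    overwrite-reachable δ g ρ ρ-involutive g₀≈ ∣Δg∣≤1 gρ≈ =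
      overwrite w g X , overwrite-lipschitz g g₀≈ ∣Δg∣≤1 , π , agrees
      where
      π : Permutation′ order
      π = extend w distinct ρ ρ-involutive

      agrees : ∀ v → overwrite w g X (π ⟨$⟩ʳ v) ≈ X v + δ * χ v
      agrees v with any? (λ j → w j ≟ v)
      ... | yes (j , ≡.refl) = trans (reflexive (overwrite-∈ w distinct g X (ρ j))) (gρ≈ j)
      ... | no  ∉            = trans (reflexive (overwrite-∉ w distinct g X ∉))
        (solve 2 (λ x δ → x := x :+ δ :* :0) refl (X v) δ)

    -- Moving all vertices beyond the root together changes only the first step.
    shift-reachable : ∀ {δ} → ∣ step zero + δ ∣≤ 1# → Reachable X (λ v → δ * χ v)
    shift-reachable {δ} ∣s+δ∣≤1 = overwrite-reachable δ g id (λ _ → ≡.refl) refl ∣Δg∣≤1 g≈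
      where
      g : Fin (suc (suc k)) → Carrier
      g = X (w zero) ◂ λ i → X (w (suc i)) + δ

      ∣Δg∣≤1 : ∀ i → ∣ g (suc i) - g (inject₁ i) ∣≤ 1#
      ∣Δg∣≤1 zero    = ∣∣≤-cong
        (solve 3 (λ x y δ → x :- y :+ δ := x :+ δ :- y) refl (X (w (suc zero))) (X (w zero)) δ) ∣s+δ∣≤1
      ∣Δg∣≤1 (suc i) = ∣∣≤-cong
        (solve 3 (λ x y δ → x :- y := x :+ δ :- (y :+ δ)) refl _ _ δ) (∣step∣≤1 (suc i))

      g≈ : ∀ j → g j ≈ X (w j) + δ * aboveRoot j
      g≈ zero    = solve 2 (λ x δ → x := x :+ δ :* :0) refl _ δ
      g≈ (suc i) = +-congˡ (sym (*-identityʳ δ))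

    module _ {d : Carrier} (step≈d : ∀ i → step (suc i) ≈ d) where

      X-above-root : ∀ i → X (w (suc i)) ≈ X (w (suc zero)) + fromℕ# (toℕ i) * d
      X-above-root = <-weakInduction _
        (solve 2 (λ x d → x := x :+ :0 :* d) refl _ d)
        λ i IH → trans
          (solve 2 (λ x y → x := y :+ (x :- y)) refl (X (w (suc (suc i)))) (X (w (suc (inject₁ i)))))
          (trans (+-cong IH (step≈d i)) (trans
            (+-congʳ (+-congˡ (*-congʳ (reflexive (≡.cong fromℕ# (toℕ-inject₁ i))))))
            (solve 3 (λ x n d → x :+ n :* d :+ d := x :+ (:1 :+ n) :* d) refl _ (fromℕ# (toℕ i)) d)))

    -- Mirror positions sum to k; this turns a reflected arithmetic progression into a translate of
    -- the original.
    opposite-fromℕ# : ∀ (i : Fin (suc k)) → fromℕ# (toℕ i) + fromℕ# (toℕ (opposite i)) ≈ fromℕ# k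
    opposite-fromℕ# i = trans (sym (×-homo-+ 1# (toℕ i) (toℕ (opposite i))))
      (reflexive (≡.cong fromℕ# (≡.trans (≡.cong (toℕ i ℕ.+_) (opposite-prop i)) (m+[n∸m]≡n (toℕ≤pred[n] i)))))

    -- Reflecting the values above w₁ at X (w₁) yields, up to reversing the
    -- order of the vertices, the translate of those values by - k d.
    reflection-reachable : ∀ {d δ} → (∀ i → step (suc i) ≈ d) → ∣ d ∣≤ 1# → δ ≈ - (fromℕ# k * d) →
      Reachable X (λ v → δ * χ v)
    reflection-reachable {d} {δ} step≈d ∣d∣≤1 δ≈ =
      overwrite-reachable δ g ρ ρ-involutive refl ∣Δg∣≤1 gρ≈
      where
      ρ : Fin (suc (suc k)) → Fin (suc (suc k))
      ρ = zero ◂ suc ∘ opposite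

      ρ-involutive : ∀ j → ρ (ρ j) ≡ j
      ρ-involutive zero    = ≡.refl
      ρ-involutive (suc i) = ≡.cong suc (opposite-involutive i)

      g : Fin (suc (suc k)) → Carrier
      g = X (w zero) ◂ λ i → X (w (suc zero)) - fromℕ# (toℕ i) * d

      ∣Δg∣≤1 : ∀ i → ∣ g (suc i) - g (inject₁ i) ∣≤ 1#
      ∣Δg∣≤1 zero    = ∣∣≤-cong
        (solve 3 (λ x y d → x :- y := x :- :0 :* d :- y) refl _ _ d) (∣step∣≤1 zero)
      ∣Δg∣≤1 (suc i) = ∣∣≤-cong
        (trans
          (solve 3 (λ x n d → :- d := x :- (:1 :+ n) :* d :- (x :- n :* d)) refl
            (X (w (suc zero))) (fromℕ# (toℕ i)) d)
          (+-congˡ (-‿cong (+-congˡ (-‿cong (*-congʳ (reflexive (≡.cong fromℕ# (≡.sym (toℕ-inject₁ i))))))))))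
        (∣-∣≤ ∣d∣≤1)

      gρ≈ : ∀ j → g (ρ j) ≈ X (w j) + δ * aboveRoot j
      gρ≈ zero    = solve 2 (λ x δ → x := x :+ δ :* :0) refl _ δ
      -- With m and n the positions of `i` and `opposite i`, rewrite x - nd as x + md - (m + n)d,
      -- where m + n = k.
      gρ≈ (suc i) = trans
        (solve 4 (λ x m n d → x :- n :* d := x :+ m :* d :+ :- ((m :+ n) :* d) :* :1) refl
          (X (w (suc zero))) (fromℕ# (toℕ i)) (fromℕ# (toℕ (opposite i))) d)
        (+-cong (sym (X-above-root step≈d i))
          (*-congʳ (trans (-‿cong (*-congʳ (opposite-fromℕ# i))) (sym δ≈))))

    -- The amount is extremal: it takes the first step to exactly 1, as `shift-down` takes it to
    -- exactly -1.
    shift-up : step zero < 1# → Reachable X (λ v → (1# - step zero) * χ v)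
    shift-up s<1 = shift-reachable (∣∣≤-cong
      (solve 1 (λ s → :1 := s :+ (:1 :- s)) refl (step zero))
      (≤-trans (proj₁ (∣step∣≤1 zero)) (<⇒≤ s<1) , ≤-reflexive refl))

    shift-down : - 1# < step zero → Reachable X (λ v → - (step zero - - 1#) * χ v)
    shift-down -1<s = shift-reachable (∣∣≤-cong
      (solve 1 (λ s → :- :1 := s :- (s :- :- :1)) refl (step zero))
      (≤-reflexive refl , ≤-trans (<⇒≤ -1<s) (proj₂ (∣step∣≤1 zero))))

    χ-nonconstant : χ (w zero) < χ (w (suc zero))
    χ-nonconstant = <-respˡ-≈ (reflexive (≡.sym (overwrite-∈ w distinct aboveRoot _ zero)))
      (<-respʳ-≈ (reflexive (≡.sym (overwrite-∈ w distinct aboveRoot _ (suc zero)))) 0<1)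

  -- Equality of the steps of a hair at an optimal function.

  module _ {t : Carrier} (0<t : 0# < t) {X : V → Carrier} (X-optimal : Optimal t X) where

    private X-lipschitz = proj₁ X-optimal

    -- A constructive form of the dichotomy that the first step is 1 or -1: strictly in between,
    -- both shifts would be reachable.
    -1<step⇒1≤step : ∀ {k} {w : Fin (suc (suc k)) → V} (hair : IsHair w) →
                     - 1# < step X-lipschitz hair zero → 1# ≤ step X-lipschitz hair zero
    -1<step⇒1≤step hair -1<s s<1 = not-both-directions 0<t X-optimal (χ-nonconstant X-lipschitz hair)
      (x<y⇒0<y-x s<1) (x<y⇒0<y-x -1<s) (shift-up X-lipschitz hair s<1) (shift-down X-lipschitz hair -1<s)

    -- The reflection translates against the sign of d. If s < d, then d is positive, so the
    -- reflection goes down while the first step still has room to go up; if d < s, all directions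
    -- are reversed.
    first-steps≈ : ∀ {k} {w : Fin (suc (suc (suc k))) → V} (hair : IsHair w) →
      let s = step X-lipschitz hair in
      (∀ i → s (suc i) ≈ s (suc zero)) → s zero ≈ s (suc zero)
    first-steps≈ {k} {w} hair step≈d = ≤-antisym d≮s s≮d
      where
      s = step X-lipschitz hair zero
      d = step X-lipschitz hair (suc zero)
      ∣s∣≤1 = ∣step∣≤1 X-lipschitz hair zero
      ∣d∣≤1 = ∣step∣≤1 X-lipschitz hair (suc zero)

      s≮d : ¬ s < d
      s≮d s<d = not-both-directions 0<t X-optimal (χ-nonconstant X-lipschitz hair)
        -- The factor `suc k` is the number of steps after the first; it is at least 1, so the
        -- reflection really moves the values.
        (x<y⇒0<y-x s<1) (*-pos (fromℕ#-pos k) 0<d)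
        (shift-up X-lipschitz hair s<1)
        (reflection-reachable X-lipschitz hair step≈d ∣d∣≤1 refl)
        where
        s<1 = <-≤-trans s<d (proj₂ ∣d∣≤1)
        -- `d` is the first step of the hair rooted at `w₁`, so the dichotomy applies to it, and d >
        -- s ≥ -1 leaves only d ≥ 1.
        0<d = <-≤-trans 0<1 (-1<step⇒1≤step (drop-root hair) (≤-<-trans (proj₁ ∣s∣≤1) s<d))

      d≮s : ¬ d < s
      d≮s d<s = not-both-directions 0<t X-optimal (χ-nonconstant X-lipschitz hair)
        (*-pos (fromℕ#-pos k) 0<-d) (x<y⇒0<y-x -1<s)
        (reflection-reachable X-lipschitz hair step≈d ∣d∣≤1
          -- Now d is negative, so the same translation is written as a positive multiple of `χ`.
          (solve 2 (λ n d → n :* :- d := :- (n :* d)) refl (fromℕ# (suc k)) d))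
        (shift-down X-lipschitz hair -1<s)
        where
        -1<s = ≤-<-trans (proj₁ ∣d∣≤1) d<s
        d<1 = <-≤-trans d<s (proj₂ ∣s∣≤1)
        d≤-1 : d ≤ - 1#
        d≤-1 -1<d = -1<step⇒1≤step (drop-root hair) -1<d d<1
        0<-d = <-≤-trans 0<1 (begin
          1#          ≈⟨ solve 0 (:1 := :- :- :1) refl ⟩
          - (- 1#)    ≤⟨ neg-mono-≤ d≤-1 ⟩
          - d         ∎)

    step≈first-step : ∀ {k} {w : Fin (suc (suc k)) → V} (hair : IsHair w) i →
      step X-lipschitz hair i ≈ step X-lipschitz hair zero
    step≈first-step         hair zero    = refl
    step≈first-step {suc k} hair (suc i) = trans (tail≈ i) (sym (first-steps≈ hair tail≈))
      where
      tail≈ : ∀ i → step X-lipschitz hair (suc i) ≈ step X-lipschitz hair (suc zero)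
      -- The steps of the shortened hair are definitionally the later steps of `hair`.
      tail≈ = step≈first-step (drop-root hair)

lemma2p10 : ∀ {c ℓ₁ ℓ₂ : Level} (ℛ : Reals c ℓ₁ ℓ₂) (G : Graph) →
    let open Reals ℛ
        open Graph G
        open LipschitzFunctions ℛ G
    in Connected →
       ∀ (t : Carrier) → 0# < t →
       ∀ (X : V → Carrier) → Optimal t X →
       -- the hair is w₀, …, w_{k+1}, so it has at least one edge
       ∀ (k : ℕ) (w : Fin (suc (suc k)) → V) → IsHair w →
       ∀ (m M : Carrier) →
       IsMinimumOf m (λ i → X (w i)) → IsMaximumOf M (λ i → X (w i)) →
       -- M - m is the integer n
       ∀ (n : ℕ) → M - m ≈ fromℕ# n →
       ∀ (u : Fin (n ∸ 1) → V) →
       (∀ i → X (u i) ≈ m + fromℕ# (suc (toℕ i))) →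
       (∀ i (j : Fin (suc k)) → u i ≢ w (suc j)) →
       ∀ (i i′ : Fin (suc k)) →
       X (w (suc i)) - X (w (inject₁ i)) ≈ X (w (suc i′)) - X (w (inject₁ i′))
lemma2p10 ℛ G _ t 0<t X X-optimal k w hair _ _ _ _ _ _ _ _ _ i i′ =
  trans (step≈first-step 0<t X-optimal hair i) (sym (step≈first-step 0<t X-optimal hair i′))
  where
  open Reals ℛ using (trans; sym)
  open LipschitzHairs ℛ G
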